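{- Let $G$ be a graph with no induced subgraph isomorphic to $C_4$. Then $G$ is localizable if and only if every vertex of $G$ is contained in exactly one simplicial clique of $G$.
   Context: A clique is strong if it intersects every maximal independent set. A graph is localizable if its vertex set admits a partition into strong cliques. A clique $C$ of $G$ is simplicial if there is a vertex $v\in V(G)$ with $C=N[v]$, the closed neighborhood of $v$. -}

module Defs where

open import Data.Nat.Base using (ℕ; suc)
open import Data.Nat.DivMod using (_%_)
import Data.Nat.Properties as ℕ
open import Data.Fin.Base using (Fin; zero; suc; toℕ)
open import Data.Fin.Properties using (_≟_)
open import Data.Fin.Subset using (Subset; _∈_; _⊆_; _∩_; Nonempty; Empty)
open import Data.List.Base using (List)
open import Data.List.Relation.Unary.All using (All)
open import Data.List.Relation.Unary.Any using (Any)
open import Data.List.Relation.Unary.AllPairs using (AllPairs)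
open import Data.Product.Base using (_×_; Σ-syntax; ∃-syntax)
open import Data.Sum.Base using (_⊎_; inj₁; inj₂; swap)
open import Data.Vec.Base using (tabulate)
open import Function.Bundles using (_⇔_)
open import Function.Definitions using (Injective)
open import Level using (0ℓ)
open import Relation.Binary.Core using (Rel)
open import Relation.Binary.Definitions using (Decidable; Irreflexive; Symmetric)
open import Relation.Binary.PropositionalEquality.Core using (_≡_; _≢_; refl)
open import Relation.Nullary.Decidable using (does; _⊎-dec_)
open import Relation.Nullary.Negation using (¬_)

-- Adjacency is decidable: graphs are finite, simple and undirected, and the
-- classical reading of the notions below is then available constructively.
record Graph (n : ℕ) : Set₁ where
  infix 4 _~_ _~?_
  field
    _~_    : Rel (Fin n) 0ℓ
    sym    : Symmetric _~_
    irrefl : Irreflexive _≡_ _~_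
    _~?_   : Decidable _~_

-- H is isomorphic to the subgraph of G induced by the image of f.
record InducedEmbedding {m n : ℕ} (H : Graph m) (G : Graph n) : Set where
  private
    module H = Graph H
    module G = Graph G
  field
    f         : Fin m → Fin n
    injective : Injective _≡_ _≡_ f
    adjacency : ∀ i j → (i H.~ j) ⇔ (f i G.~ f j)

C₄ : Graph 4
C₄ = record
  { _~_    = λ i j → Next i j ⊎ Next j i
  ; sym    = swap
  ; irrefl = λ { refl (inj₁ e) → next-irrefl _ e ; refl (inj₂ e) → next-irrefl _ e }
  ; _~?_   = λ i j → next? i j ⊎-dec next? j i
  }
  where
  Next : Rel (Fin 4) 0ℓ
  Next i j = toℕ j ≡ suc (toℕ i) % 4

  next? : Decidable Next
  next? i j = toℕ j ℕ.≟ suc (toℕ i) % 4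

  next-irrefl : ∀ i → ¬ Next i i
  next-irrefl zero                   ()
  next-irrefl (suc zero)             ()
  next-irrefl (suc (suc zero))       ()
  next-irrefl (suc (suc (suc zero))) ()

module _ {n : ℕ} (G : Graph n) where
  open Graph G

  C₄-Free : Set
  C₄-Free = ¬ InducedEmbedding C₄ G

  IsClique : Subset n → Set
  IsClique C = ∀ {u v} → u ∈ C → v ∈ C → u ≢ v → u ~ v

  IsIndependent : Subset n → Set
  IsIndependent I = ∀ {u v} → u ∈ I → v ∈ I → ¬ (u ~ v)

  IsMaximalIndependent : Subset n → Set
  IsMaximalIndependent I =
    IsIndependent I × (∀ J → IsIndependent J → I ⊆ J → J ⊆ I)

  IsStrongClique : Subset n → Set
  IsStrongClique C =
    IsClique C × (∀ I → IsMaximalIndependent I → Nonempty (C ∩ I))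

  N[_] : Fin n → Subset n
  N[ v ] = tabulate λ u → does ((u ≟ v) ⊎-dec (v ~? u))

  IsSimplicialClique : Subset n → Set
  IsSimplicialClique C = IsClique C × ∃[ v ] C ≡ N[ v ]

  Localizable : Set
  Localizable =
    Σ[ 𝒫 ∈ List (Subset n) ] IsPartition 𝒫 × All IsStrongClique 𝒫
    where
    -- Nonempty pairwise disjoint blocks, so no block is listed twice.
    IsPartition : List (Subset n) → Set
    IsPartition 𝒫 =
      All Nonempty 𝒫 ×
      AllPairs (λ C D → Empty (C ∩ D)) 𝒫 ×
      (∀ v → Any (v ∈_) 𝒫)

{-# OPTIONS --safe #-}
-- In a C₄-free graph every strong clique C is simplicial. The traces on C of
-- two adjacent vertices x, y outside C are nested: a ∈ C seen only by x and
-- b ∈ C seen only by y would give an induced 4-cycle x y b a. Hence the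
-- outside vertices can be thinned to an independent set I with the same
-- neighbours in C. If no vertex of C had its closed neighbourhood inside C,
-- every vertex of C would have a neighbour in I, and a maximal independent
-- set containing I would miss C. Conversely, in any graph a simplicial clique
-- N[v] is strong, since a maximal independent set avoiding N[v] could be
-- enlarged by v.
module Submission where

open import Defs
open import Data.Nat.Base using (ℕ)
open import Data.Fin.Base using (Fin; zero; suc)
open import Data.Fin.Properties using (any?; all?) renaming (_≟_ to _≟ᶠ_)
open import Data.Fin.Subset using (Subset; _∈_; _∉_; _⊆_; _∩_; _∪_; ∁; ⁅_⁆; ⊥; Nonempty; Empty)
open import Data.Fin.Subset.Properties
open import Data.Bool.Properties using () renaming (_≟_ to _≟ᵇ_)
open import Data.List.Base using (List; []; _∷_; map; allFin; deduplicate)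
open import Data.List.Membership.Propositional using (find) renaming (_∈_ to _∈ₗ_)
open import Data.List.Membership.Propositional.Properties using (∈-allFin)
open import Data.List.Relation.Unary.All as All using (All)
import Data.List.Relation.Unary.All.Properties as All
open import Data.List.Relation.Unary.Any as Any using (Any; here; there)
import Data.List.Relation.Unary.Any.Properties as Any
open import Data.List.Relation.Unary.AllPairs as AllPairs using (AllPairs; []; _∷_)
import Data.List.Relation.Unary.AllPairs.Properties as AllPairs
open import Data.List.Relation.Unary.Unique.DecSetoid.Properties using (deduplicate-!)
open import Data.Product using (_×_; _,_; ∃-syntax; ∃!; proj₁; proj₂)
open import Data.Sum.Base using (_⊎_; inj₁; inj₂; [_,_]′)
open import Data.Vec.Base using (Vec; []; _∷_; lookup)
open import Data.Vec.Properties using (≡-dec; lookup⇒[]=; []=⇒lookup; lookup∘tabulate)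
open import Data.Vec.Relation.Unary.All using ([]; _∷_)
open import Data.Vec.Relation.Unary.AllPairs using ([]; _∷_)
open import Data.Vec.Relation.Unary.Unique.Propositional.Properties using (lookup-injective)
open import Function.Base using (_∘_; const)
open import Function.Bundles using (_⇔_; mk⇔)
open import Relation.Binary.Bundles using (DecSetoid)
import Relation.Binary.Construct.On as On
open import Relation.Binary.PropositionalEquality.Core using (_≡_; _≢_; refl; sym; trans; subst)
open import Relation.Binary.PropositionalEquality.Properties using (decSetoid)
open import Relation.Nullary.Decidable using (yes; no; True; False; toWitness; toWitnessFalse; dec-true; dec-false; ¬?; _×-dec_; _⊎-dec_; _→-dec_; decidable-stable)
open import Relation.Nullary.Negation using (¬_; contradiction)

module _ {n : ℕ} (G : Graph n) where
  open Graph G renaming (sym to ~-sym)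

  private variable
    u v w x y : Fin n
    C D I J : Subset n

  -- Recognising induced 4-cycles.

  ~⇒≢ : u ~ v → u ≢ v
  ~⇒≢ u~v u≡v = irrefl u≡v u~v

  -- Adjacency is irreflexive, so consecutive vertices are distinct and only the two diagonals need
  -- inequality hypotheses.
  induced-C₄ : ∀ {a b c d} → a ~ b → b ~ c → c ~ d → d ~ a →
               ¬ a ~ c → ¬ b ~ d → a ≢ c → b ≢ d → InducedEmbedding C₄ G
  induced-C₄ {a} {b} {c} {d} a~b b~c c~d d~a a≁c b≁d a≢c b≢d = record
    { f         = lookup vs
    ; injective = lookup-injective
        ((~⇒≢ a~b ∷ a≢c ∷ ~⇒≢ (~-sym d~a) ∷ []) ∷ (~⇒≢ b~c ∷ b≢d ∷ []) ∷ (~⇒≢ c~d ∷ []) ∷ [] ∷ []) _ _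
    ; adjacency = adjacency
    }
    where
    vs : Vec (Fin n) 4
    vs = a ∷ b ∷ c ∷ d ∷ []

    module C₄ = Graph C₄

    -- At concrete indices the implicit argument is found by evaluating `C₄.~?`, so each of the
    -- sixteen cases only concerns `G`.
    edge : ∀ {i j} {_ : True (i C₄.~? j)} → lookup vs i ~ lookup vs j →
           (i C₄.~ j) ⇔ (lookup vs i ~ lookup vs j)
    edge {_} {_} {t} e = mk⇔ (const e) (const (toWitness t))

    nonedge : ∀ {i j} {_ : False (i C₄.~? j)} → ¬ lookup vs i ~ lookup vs j →
              (i C₄.~ j) ⇔ (lookup vs i ~ lookup vs j)
    nonedge {_} {_} {t} ne = mk⇔ (λ e → contradiction e (toWitnessFalse t)) (λ e → contradiction e ne)

    pattern 0F = zero
    pattern 1F = suc zero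
    pattern 2F = suc (suc zero)
    pattern 3F = suc (suc (suc zero))

    adjacency : ∀ i j → (i C₄.~ j) ⇔ (lookup vs i ~ lookup vs j)
    adjacency 0F 0F = nonedge (irrefl refl)
    adjacency 0F 1F = edge a~b
    adjacency 0F 2F = nonedge a≁c
    adjacency 0F 3F = edge (~-sym d~a)
    adjacency 1F 0F = edge (~-sym a~b)
    adjacency 1F 1F = nonedge (irrefl refl)
    adjacency 1F 2F = edge b~c
    adjacency 1F 3F = nonedge b≁d
    adjacency 2F 0F = nonedge (a≁c ∘ ~-sym)
    adjacency 2F 1F = edge (~-sym b~c)
    adjacency 2F 2F = nonedge (irrefl refl)
    adjacency 2F 3F = edge c~d
    adjacency 3F 0F = edge d~a
    adjacency 3F 1F = nonedge (b≁d ∘ ~-sym)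
    adjacency 3F 2F = edge (~-sym c~d)
    adjacency 3F 3F = nonedge (irrefl refl)

  -- Closed neighbourhoods and strength of simplicial cliques.

  ∈N[]⁺ : v ≡ u ⊎ v ~ u → u ∈ N[_] G v
  ∈N[]⁺ {v} {u} p = lookup⇒[]= u _ (trans (lookup∘tabulate _ u)
    (dec-true ((u ≟ᶠ v) ⊎-dec (v ~? u)) ([ inj₁ ∘ sym , inj₂ ]′ p)))

  ∈N[]⁻ : u ∈ N[_] G v → v ≡ u ⊎ v ~ u
  ∈N[]⁻ {u} {v} u∈N = [ inj₁ ∘ sym , inj₂ ]′ (decidable-stable u∈N? λ u∉N →
    contradiction (trans (sym (dec-false u∈N? u∉N)) (trans (sym (lookup∘tabulate _ u)) ([]=⇒lookup u∈N))) λ ())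
    where u∈N? = (u ≟ᶠ v) ⊎-dec (v ~? u)

  v∈N[v] : v ∈ N[_] G v
  v∈N[v] = ∈N[]⁺ (inj₁ refl)

  clique⊆N[] : IsClique G C → v ∈ C → C ⊆ N[_] G v
  clique⊆N[] {v = v} clique v∈C {u} u∈C with v ≟ᶠ u
  ... | yes v≡u = ∈N[]⁺ (inj₁ v≡u)
  ... | no  v≢u = ∈N[]⁺ (inj₂ (clique v∈C u∈C v≢u))

  ∪-⁅⁆-independent : IsIndependent G I → (∀ {u} → u ∈ I → ¬ x ~ u) →
                     IsIndependent G (I ∪ ⁅ x ⁆)
  ∪-⁅⁆-independent {I} {x} ind x≁I u∈ v∈ u~v
    with x∈p∪q⁻ I ⁅ x ⁆ u∈ | x∈p∪q⁻ I ⁅ x ⁆ v∈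
  ... | inj₁ u∈I | inj₁ v∈I = ind u∈I v∈I u~v
  ... | inj₁ u∈I | inj₂ v∈x with refl ← x∈⁅y⁆⇒x≡y x v∈x = x≁I u∈I (~-sym u~v)
  ... | inj₂ u∈x | inj₁ v∈I with refl ← x∈⁅y⁆⇒x≡y x u∈x = x≁I v∈I u~v
  ... | inj₂ u∈x | inj₂ v∈x
    with refl ← x∈⁅y⁆⇒x≡y x u∈x | refl ← x∈⁅y⁆⇒x≡y x v∈x = irrefl refl u~v

  x∈p∪⁅x⁆ : x ∈ I ∪ ⁅ x ⁆
  x∈p∪⁅x⁆ {x} = x∈p∪q⁺ (inj₂ (x∈⁅x⁆ x))

  simplicial⇒strong : IsSimplicialClique G C → IsStrongClique G C
  simplicial⇒strong (clique , v , refl) = clique , meets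
    where
    meets : ∀ I → IsMaximalIndependent G I → Nonempty (N[_] G v ∩ I)
    meets I (ind , max) with nonempty? (N[_] G v ∩ I)
    ... | yes ne = ne
    ... | no disjoint = contradiction (v , x∈p∩q⁺ (v∈N[v] , v∈I)) disjoint
      where
      v∈I : v ∈ I
      v∈I = max (I ∪ ⁅ v ⁆)
        (∪-⁅⁆-independent ind λ u∈I v~u → disjoint (_ , x∈p∩q⁺ (∈N[]⁺ (inj₂ v~u) , u∈I)))
        (p⊆p∪q ⁅ v ⁆) x∈p∪⁅x⁆

  -- Greedy extension to a maximal independent set.

  Dominates : Subset n → Fin n → Set
  Dominates I v = v ∈ I ⊎ ∃[ w ] w ∈ I × v ~ w

  -- Each listed vertex is inserted unless it already has a neighbour in the set. Either way it
  -- becomes dominated, and it stays so as the set grows.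
  greedy-extension : IsIndependent G I → ∀ L →
    ∃[ J ] IsIndependent G J × I ⊆ J × All (Dominates J) L
  greedy-extension {I} ind [] = I , ind , (λ v∈I → v∈I) , All.[]
  greedy-extension ind (x ∷ L) with greedy-extension ind L
  ... | J , indJ , I⊆J , dom with any? (λ w → (w ∈? J) ×-dec (x ~? w))
  ... | yes nbr  = J , indJ , I⊆J , inj₂ nbr All.∷ dom
  ... | no ¬nbr  =
    J ∪ ⁅ x ⁆ ,
    ∪-⁅⁆-independent indJ (λ u∈J x~u → ¬nbr (_ , u∈J , x~u)) ,
    p⊆p∪q ⁅ x ⁆ ∘ I⊆J ,
    inj₁ x∈p∪⁅x⁆ All.∷ All.map weaken dom
    where
    weaken : Dominates J v → Dominates (J ∪ ⁅ x ⁆) v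
    weaken (inj₁ v∈J)             = inj₁ (p⊆p∪q ⁅ x ⁆ v∈J)
    weaken (inj₂ (w , w∈J , v~w)) = inj₂ (w , p⊆p∪q ⁅ x ⁆ w∈J , v~w)

  independent⇒⊆maximal : IsIndependent G I → ∃[ J ] IsMaximalIndependent G J × I ⊆ J
  independent⇒⊆maximal ind with greedy-extension ind (allFin n)
  ... | J , indJ , I⊆J , dom = J , (indJ , max) , I⊆J
    where
    -- A vertex of `K` outside `J` would have a neighbour in `J`, hence in the independent set `K`.
    max : ∀ K → IsIndependent G K → J ⊆ K → K ⊆ J
    max K indK J⊆K {v} v∈K with All.lookup dom (∈-allFin v)
    ... | inj₁ v∈J             = v∈J
    ... | inj₂ (w , w∈J , v~w) = contradiction v~w (indK v∈K (J⊆K w∈J))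

  -- A maximal independent set containing `I` would meet `C` in a vertex that has a neighbour in
  -- `I`, giving two adjacent members.
  strong⇒undominated : IsStrongClique G C → IsIndependent G I →
                       ¬ (∀ v → v ∈ C → ∃[ w ] w ∈ I × v ~ w)
  strong⇒undominated {C} (_ , strong) ind dom
    with J , maxJ@(indJ , _) , I⊆J ← independent⇒⊆maximal ind
    with v , v∈C∩J ← strong J maxJ
    with v∈C , v∈J ← x∈p∩q⁻ C J v∈C∩J
    with w , w∈I , v~w ← dom v v∈C
    = indJ v∈J (I⊆J w∈I) v~w

  -- Traces of outside vertices on a strong clique.

  nested-traces : C₄-Free G → IsClique G C → x ∉ C → y ∉ C → x ~ y →
                  v ∈ C → y ~ v → ¬ x ~ v →
                  ∀ u → u ∈ C → x ~ u → y ~ u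
  nested-traces {y = y} C₄-free clique x∉C y∉C x~y v∈C y~v x≁v u u∈C x~u =
    decidable-stable (y ~? u) λ y≁u → C₄-free
      -- The cycle is `x`, `y`, `v`, `u`. Each diagonal joins a vertex outside `C` to one inside, so
      -- its ends differ.
      (induced-C₄ x~y y~v (clique v∈C u∈C λ { refl → x≁v x~u }) (~-sym x~u)
        x≁v y≁u (λ { refl → x∉C v∈C }) (λ { refl → y∉C u∈C }))

  -- A new vertex x is dropped if its trace on C lies in that of a neighbour in
  -- I; otherwise nestedness lets x replace all its neighbours in I.
  independent-with-trace : C₄-Free G → IsClique G C → ∀ L →
    ∃[ I ] IsIndependent G I × (∀ {u} → u ∈ I → u ∉ C) ×
      (∀ {u v} → u ∈ₗ L → u ∉ C → v ∈ C → v ~ u → ∃[ w ] w ∈ I × v ~ w)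
  independent-with-trace C₄-free clique [] =
    ⊥ , (λ u∈⊥ → contradiction u∈⊥ ∉⊥) , (λ u∈⊥ → contradiction u∈⊥ ∉⊥) , λ ()
  independent-with-trace {C} C₄-free clique (x ∷ L)
    with independent-with-trace C₄-free clique L
  ... | I , ind , I∉C , covers with x ∈? C
  ... | yes x∈C = I , ind , I∉C , λ
    { (here refl) x∉C → contradiction x∈C x∉C
    ; (there u∈L)     → covers u∈L
    }
  ... | no x∉C
    with any? (λ y → (y ∈? I) ×-dec (x ~? y) ×-dec
                     all? (λ u → (u ∈? C) →-dec (x ~? u) →-dec (y ~? u)))
  ... | yes (y , y∈I , _ , trace⊆) = I , ind , I∉C , λ
    { (here refl) _ v∈C v~x → y , y∈I , ~-sym (trace⊆ _ v∈C (~-sym v~x))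
    ; (there u∈L)           → covers u∈L
    }
  ... | no ¬trace⊆ = I′ ∪ ⁅ x ⁆ , ind′ , I′∉C , covers′
    where
    I′ : Subset n
    I′ = I ∩ ∁ (N[_] G x)

    I′⊆I : I′ ⊆ I
    I′⊆I = p∩q⊆p I (∁ (N[_] G x))

    ind′ : IsIndependent G (I′ ∪ ⁅ x ⁆)
    ind′ = ∪-⁅⁆-independent (λ u∈ v∈ → ind (I′⊆I u∈) (I′⊆I v∈))
      λ u∈I′ x~u → x∈∁p⇒x∉p (p∩q⊆q I (∁ (N[_] G x)) u∈I′) (∈N[]⁺ (inj₂ x~u))

    I′∉C : u ∈ I′ ∪ ⁅ x ⁆ → u ∉ C
    I′∉C u∈ with x∈p∪q⁻ I′ ⁅ x ⁆ u∈
    ... | inj₁ u∈I′ = I∉C (I′⊆I u∈I′)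
    ... | inj₂ u∈x with refl ← x∈⁅y⁆⇒x≡y x u∈x = x∉C

    covers′ : u ∈ₗ x ∷ L → u ∉ C → v ∈ C → v ~ u → ∃[ w ] w ∈ I′ ∪ ⁅ x ⁆ × v ~ w
    covers′ (here refl) _ _ v~x = x , x∈p∪⁅x⁆ , v~x
    covers′ {v = v} (there u∈L) u∉C v∈C v~u with covers u∈L u∉C v∈C v~u
    ... | w , w∈I , v~w with w ∈? N[_] G x
    ... | no w∉N = w , p⊆p∪q ⁅ x ⁆ (x∈p∩q⁺ (w∈I , x∉p⇒x∈∁p w∉N)) , v~w
    ... | yes w∈N with ∈N[]⁻ w∈N
    ... | inj₁ refl = x , x∈p∪⁅x⁆ , v~w
    -- The old witness `w` was removed, so `x` must see `v`. Otherwise nestedness puts the trace of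
    -- `x` inside that of `w`, the case already excluded; `I∉C` supplies that `w` is outside `C`.
    ... | inj₂ x~w  = x , x∈p∪⁅x⁆ , ~-sym (decidable-stable (x ~? v) λ x≁v →
      ¬trace⊆ (w , w∈I , x~w ,
        nested-traces C₄-free clique x∉C (I∉C w∈I) x~w v∈C (~-sym v~w) x≁v))

  strong⇒simplicial : C₄-Free G → IsStrongClique G C → IsSimplicialClique G C
  strong⇒simplicial {C} C₄-free strong@(clique , _)
    with any? (λ v → (v ∈? C) ×-dec (N[_] G v ⊆? C))
  ... | yes (v , v∈C , N⊆C) = clique , v , ⊆-antisym (clique⊆N[] clique v∈C) N⊆C
  ... | no ¬N⊆C with independent-with-trace C₄-free clique (allFin n)
  ... | I , ind , _ , covers = contradiction dominated (strong⇒undominated strong ind)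
    where
    -- The search over finitely many vertices is decidable, so failure of `N[ v ] ⊆ C` yields an
    -- actual neighbour outside `C`.
    outside-neighbour : v ∈ C → ∃[ u ] u ∉ C × v ~ u
    outside-neighbour {v} v∈C = decidable-stable
      (any? λ u → ¬? (u ∈? C) ×-dec (v ~? u))
      λ none → ¬N⊆C (v , v∈C , λ {u} u∈N → decidable-stable (u ∈? C) λ u∉C →
        [ (λ { refl → u∉C v∈C }) , (λ v~u → none (u , u∉C , v~u)) ]′ (∈N[]⁻ u∈N))

    dominated : ∀ v → v ∈ C → ∃[ w ] w ∈ I × v ~ w
    dominated v v∈C with u , u∉C , v~u ← outside-neighbour v∈C =
      covers (∈-allFin u) u∉C v∈C v~u

  -- Partitions into strong cliques versus unique simplicial cliques.

  simplicial-∋w⇒≡N[w] : IsSimplicialClique G C → IsClique G (N[_] G w) → w ∈ C → C ≡ N[_] G w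
  simplicial-∋w⇒≡N[w] {w = w} (clique , w′ , refl) cliqueN w∈C = ⊆-antisym
    (clique⊆N[] clique w∈C)
    -- By symmetry of adjacency the centre `w′` lies in `N[ w ]`, and a clique lies in the closed
    -- neighbourhood of each of its members.
    (clique⊆N[] cliqueN ([ (λ { refl → v∈N[v] }) , ∈N[]⁺ ∘ inj₂ ∘ ~-sym ]′ (∈N[]⁻ w∈C)))

  UniquelySimplicial : Set
  UniquelySimplicial = ∀ v → ∃! _≡_ (λ C → IsSimplicialClique G C × v ∈ C)

  disjoint-∋-unique : ∀ {𝒫} → AllPairs (λ C D → Empty (C ∩ D)) 𝒫 →
                      C ∈ₗ 𝒫 → D ∈ₗ 𝒫 → v ∈ C → v ∈ D → C ≡ D
  disjoint-∋-unique (_ ∷ _) (here refl) (here refl) _ _ = refl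
  disjoint-∋-unique (dis ∷ _) (here refl) (there D∈) v∈C v∈D =
    contradiction (_ , x∈p∩q⁺ (v∈C , v∈D)) (All.lookup dis D∈)
  disjoint-∋-unique (dis ∷ _) (there C∈) (here refl) v∈C v∈D =
    contradiction (_ , x∈p∩q⁺ (v∈D , v∈C)) (All.lookup dis C∈)
  disjoint-∋-unique (_ ∷ rest) (there C∈) (there D∈) = disjoint-∋-unique rest C∈ D∈

  localizable⇒unique : C₄-Free G → Localizable G → UniquelySimplicial
  localizable⇒unique C₄-free (𝒫 , (_ , disjoint , cover) , strong) v
    with C , C∈𝒫 , v∈C ← find (cover v)
    = C , (simplicial C∈𝒫 , v∈C) , λ { {D} (simplD , v∈D) →
        disjoint-∋-unique disjoint C∈𝒫 (simplicial⇒∈𝒫 simplD) v∈C v∈D }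
    where
    simplicial : D ∈ₗ 𝒫 → IsSimplicialClique G D
    simplicial D∈ = strong⇒simplicial C₄-free (All.lookup strong D∈)

    -- The block covering the centre `w` is itself simplicial, hence equals `N[ w ]`. So any two
    -- simplicial cliques through `v` are blocks that meet.
    simplicial⇒∈𝒫 : IsSimplicialClique G D → D ∈ₗ 𝒫
    simplicial⇒∈𝒫 (cliqueD , w , refl) with C , C∈𝒫 , w∈C ← find (cover w) =
      subst (_∈ₗ 𝒫) (simplicial-∋w⇒≡N[w] (simplicial C∈𝒫) cliqueD w∈C) C∈𝒫

  unique⇒localizable : UniquelySimplicial → Localizable G
  unique⇒localizable unique = map block reps , (nonempty , disjoint , cover) , strong
    where
    block : Fin n → Subset n
    block v = proj₁ (unique v)

    simplicial : ∀ v → IsSimplicialClique G (block v)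
    simplicial v = proj₁ (proj₁ (proj₂ (unique v)))

    v∈block : ∀ v → v ∈ block v
    v∈block v = proj₂ (proj₁ (proj₂ (unique v)))

    ∈block⇒≡ : ∀ v → u ∈ block v → block u ≡ block v
    ∈block⇒≡ {u} v u∈ = proj₂ (proj₂ (unique u)) (simplicial v , u∈)

    -- Comparing vertices by their blocks makes deduplication keep one representative per block, so
    -- no block is listed twice.
    same-block : DecSetoid _ _
    same-block = On.decSetoid (decSetoid (≡-dec _≟ᵇ_)) block

    open DecSetoid same-block using (_≟_)

    reps : List (Fin n)
    reps = deduplicate _≟_ (allFin n)

    nonempty : All Nonempty (map block reps)
    nonempty = All.map⁺ (All.universal (λ v → v , v∈block v) reps)

    strong : All (IsStrongClique G) (map block reps)
    strong = All.map⁺ (All.universal (simplicial⇒strong ∘ simplicial) reps)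

    disjoint : AllPairs (λ C D → Empty (C ∩ D)) (map block reps)
    disjoint = AllPairs.map⁺ (AllPairs.map separate (deduplicate-! same-block (allFin n)))
      where
      separate : block u ≢ block v → Empty (block u ∩ block v)
      separate {u} {v} ≢ (w , w∈) with w∈u , w∈v ← x∈p∩q⁻ (block u) (block v) w∈ =
        ≢ (trans (sym (∈block⇒≡ u w∈u)) (∈block⇒≡ v w∈v))

    cover : ∀ v → Any (v ∈_) (map block reps)
    -- The representative kept may differ from `v`, so membership is transported along equality of
    -- blocks.
    cover v = Any.map⁺ (Any.deduplicate⁺ _≟_ (λ eq → subst (v ∈_) (sym eq))
      (Any.map (λ { refl → v∈block v }) (∈-allFin v)))

mainTheorem10 : ∀ {n : ℕ} (G : Graph n) → C₄-Free G →
    Localizable G ⇔ (∀ v → ∃! _≡_ (λ C → IsSimplicialClique G C × v ∈ C))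
mainTheorem10 G C₄-free = mk⇔ (localizable⇒unique G C₄-free) (unique⇒localizable G)
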